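{- Let $\Sigma$ be an empty signature with a finite set of sorts $\mathcal{S}_\Sigma$, and let $\mathcal{T}$ be a $\Sigma$-theory that has the finite model property and is smooth with respect to $\mathcal{S}_\Sigma$. Then $\mathcal{T}$ is finitely witnessable with respect to $\mathcal{S}_\Sigma$.
   Context: A many-sorted signature is empty if it has no function symbols and its only predicate symbols are the equality symbols $=_\sigma$, one for each sort (interpreted as identity). A $\Sigma$-interpretation $\mathcal{A}$ is a $\Sigma$-structure (nonempty domain $\sigma^{\mathcal{A}}$ per sort) together with values for all variables (each sort has a countably infinite set of variables). A $\Sigma$-theory $\mathcal{T}$ is the class of all $\Sigma$-interpretations (the $\mathcal{T}$-interpretations) satisfying a given set $Ax(\mathcal{T})$ of closed formulas. A formula is $\mathcal{T}$-satisfiable if some $\mathcal{T}$-interpretation satisfies it; two formulas are $\mathcal{T}$-equivalent if a $\mathcal{T}$-interpretation satisfies one iff it satisfies the other. $vars_\sigma(\varphi)$ denotes the free variables of sort $\sigma$ in $\varphi$, $vars(\varphi)$ all free variables, and $\Gamma^{\mathcal{A}}=\{\alpha^{\mathcal{A}}:\alpha\in\Gamma\}$. Let $S\subseteq\mathcal{S}_\Sigma$. Finite model property w.r.t. $S$: every $\mathcal{T}$-satisfiable quantifier-free formula is satisfied by a $\mathcal{T}$-interpretation $\mathcal{A}$ with $\sigma^{\mathcal{A}}$ finite for all $\sigma\in S$. Smooth w.r.t. $S$: for every quantifier-free formula $\phi$, every $\mathcal{T}$-interpretation $\mathcal{A}$ satisfying $\phi$, and every function $\kappa$ from $S$ to cardinals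 with $\kappa(\sigma)\ge|\sigma^{\mathcal{A}}|$ for all $\sigma\in S$, there is a $\mathcal{T}$-interpretation $\mathcal{B}$ satisfying $\phi$ with $|\sigma^{\mathcal{B}}|=\kappa(\sigma)$ for all $\sigma\in S$. Finitely witnessable w.r.t. $S$: there is a computable function $wit$ from quantifier-free formulas to quantifier-free formulas such that for every quantifier-free $\phi$: (i) $\phi$ and $\exists\vec w.\,wit(\phi)$ are $\mathcal{T}$-equivalent, where $\vec w=vars(wit(\phi))\setminus vars(\phi)$; (ii) if $wit(\phi)$ is $\mathcal{T}$-satisfiable, some $\mathcal{T}$-interpretation $\mathcal{A}$ satisfies $wit(\phi)$ with $\sigma^{\mathcal{A}}=vars_\sigma(wit(\phi))^{\mathcal{A}}$ for each $\sigma\in S$. -}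

module Defs where

open import Data.Fin.Base using (Fin; toℕ)
import Data.Fin.Properties as Fin
open import Data.Fin.Subset using (Subset; _∈_)
open import Data.List.Base using (List; []; _∷_; _++_; filter; foldr)
import Data.List.Membership.DecPropositional as DecMembership
open import Data.Nat.Base using (ℕ; zero; suc; _+_; _<_)
import Data.Nat.Properties as ℕ
open import Data.Product.Base using (∃; ∃-syntax; _×_; _,_; proj₁; proj₂)
open import Data.Product.Properties using (≡-dec)
open import Data.Sum.Base using (_⊎_)
open import Data.Vec.Base using (Vec; []; _∷_; lookup)
open import Data.Vec.Relation.Binary.Pointwise.Inductive using (Pointwise)
open import Function.Bundles using (_⇔_; _↔_; _↣_)
open import Relation.Binary.Definitions using (DecidableEquality)
open import Relation.Binary.PropositionalEquality using (_≡_; refl)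
open import Relation.Nullary using (¬_; ¬?; yes; no)

------------------------------------------------------------------------
-- Syntax over the empty signature with sort set Fin n.
-- With no function symbols and no predicates besides the equalities =_σ,
-- the terms are the variables and the atoms are equalities between two
-- variables of the same sort.

Var : ℕ → Set
Var n = Fin n × ℕ

_≟ᵛ_ : ∀ {n} → DecidableEquality (Var n)
_≟ᵛ_ = ≡-dec Fin._≟_ ℕ._≟_

infix  8 _≈[_]_
infix  7 ~_
infixr 6 _∧_
infixr 5 _∨_
infixr 4 _⇒_

data Formula (n : ℕ) : Set where
  _≈[_]_  : ℕ → Fin n → ℕ → Formula n
  ~_      : Formula n → Formula n
  _∧_     : Formula n → Formula n → Formula n
  _∨_     : Formula n → Formula n → Formula n
  _⇒_     : Formula n → Formula n → Formula n
  all ex  : Var n → Formula n → Formula n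

private
  variable
    n k m : ℕ

data QuantifierFree {n : ℕ} : Formula n → Set where
  qf-≈ : ∀ {i σ j} → QuantifierFree (i ≈[ σ ] j)
  qf-~ : ∀ {φ} → QuantifierFree φ → QuantifierFree (~ φ)
  qf-∧ : ∀ {φ ψ} → QuantifierFree φ → QuantifierFree ψ → QuantifierFree (φ ∧ ψ)
  qf-∨ : ∀ {φ ψ} → QuantifierFree φ → QuantifierFree ψ → QuantifierFree (φ ∨ ψ)
  qf-⇒ : ∀ {φ ψ} → QuantifierFree φ → QuantifierFree ψ → QuantifierFree (φ ⇒ ψ)

QFFormula : ℕ → Set
QFFormula n = ∃ (QuantifierFree {n})

_without_ : List (Var n) → Var n → List (Var n)
xs without x = filter (λ y → ¬? (y ≟ᵛ x)) xs

_∖_ : List (Var n) → List (Var n) → List (Var n)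
xs ∖ ys = filter (λ x → ¬? (x ∈? ys)) xs
  where open DecMembership _≟ᵛ_ using (_∈?_)

vars : Formula n → List (Var n)
vars (i ≈[ σ ] j) = (σ , i) ∷ (σ , j) ∷ []
vars (~ φ)        = vars φ
vars (φ ∧ ψ)      = vars φ ++ vars ψ
vars (φ ∨ ψ)      = vars φ ++ vars ψ
vars (φ ⇒ ψ)      = vars φ ++ vars ψ
vars (all x φ)    = vars φ without x
vars (ex x φ)     = vars φ without x

Closed : Formula n → Set
Closed φ = vars φ ≡ []

-- A list may repeat a variable; quantifying it again changes nothing.
ex* : List (Var n) → Formula n → Formula n
ex* xs φ = foldr ex φ xs

------------------------------------------------------------------------
-- Semantics

-- Domains are nonempty because every sort has variables, all of which
-- receive a value.
record Interpretation (n : ℕ) : Set₁ where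
  field
    Dom : Fin n → Set
    val : (x : Var n) → Dom (proj₁ x)

open Interpretation public

_[_↦_] : (A : Interpretation n) (x : Var n) → Dom A (proj₁ x) → Interpretation n
Dom (A [ x ↦ a ]) = Dom A
val (A [ x ↦ a ]) y with x ≟ᵛ y
... | yes refl = a
... | no  _    = val A y

infix 3 _⊨_

_⊨_ : Interpretation n → Formula n → Set
A ⊨ i ≈[ σ ] j = val A (σ , i) ≡ val A (σ , j)
A ⊨ ~ φ        = ¬ (A ⊨ φ)
A ⊨ φ ∧ ψ      = (A ⊨ φ) × (A ⊨ ψ)
A ⊨ φ ∨ ψ      = (A ⊨ φ) ⊎ (A ⊨ ψ)
A ⊨ φ ⇒ ψ      = A ⊨ φ → A ⊨ ψ
A ⊨ all x φ    = ∀ a → A [ x ↦ a ] ⊨ φ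
A ⊨ ex x φ     = ∃[ a ] (A [ x ↦ a ] ⊨ φ)

record Theory (n : ℕ) : Set₁ where
  field
    Ax     : Formula n → Set
    closed : ∀ {φ} → Ax φ → Closed φ

open Theory public

_isModelOf_ : Interpretation n → Theory n → Set
A isModelOf T = ∀ {φ} → Ax T φ → A ⊨ φ

Satisfiable : Theory n → Formula n → Set₁
Satisfiable T φ = ∃[ A ] A isModelOf T × (A ⊨ φ)

Equivalent : Theory n → Formula n → Formula n → Set₁
Equivalent T φ ψ = ∀ A → A isModelOf T → (A ⊨ φ) ⇔ (A ⊨ ψ)

------------------------------------------------------------------------
-- Computable functions: partial recursive functions, evaluated by a
-- big-step relation, acting on Gödel numbers.

data Rec : ℕ → Set where
  zeroᵣ : Rec 0
  sucᵣ  : Rec 1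
  proj  : Fin k → Rec k
  comp  : Rec m → Vec (Rec k) m → Rec k
  prec  : Rec k → Rec (2 + k) → Rec (1 + k)
  μ     : Rec (1 + k) → Rec k

infix 4 _⟨_⟩⇓_

data _⟨_⟩⇓_ : Rec k → Vec ℕ k → ℕ → Set where
  ⇓zero : zeroᵣ ⟨ [] ⟩⇓ 0
  ⇓suc  : ∀ {x} → sucᵣ ⟨ x ∷ [] ⟩⇓ suc x
  ⇓proj : ∀ {i : Fin k} {xs} → proj i ⟨ xs ⟩⇓ lookup xs i
  ⇓comp : ∀ {f : Rec m} {gs : Vec (Rec k) m} {xs ys z} →
          Pointwise (λ g y → g ⟨ xs ⟩⇓ y) gs ys → f ⟨ ys ⟩⇓ z →
          comp f gs ⟨ xs ⟩⇓ z
  ⇓prec-zero : ∀ {f : Rec k} {g xs y} →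
          f ⟨ xs ⟩⇓ y → prec f g ⟨ 0 ∷ xs ⟩⇓ y
  ⇓prec-suc  : ∀ {f : Rec k} {g xs i y z} →
          prec f g ⟨ i ∷ xs ⟩⇓ y → g ⟨ i ∷ y ∷ xs ⟩⇓ z →
          prec f g ⟨ suc i ∷ xs ⟩⇓ z
  ⇓μ    : ∀ {f : Rec (1 + k)} {xs y} →
          (∀ {i} → i < y → ∃[ z ] f ⟨ i ∷ xs ⟩⇓ suc z) →
          f ⟨ y ∷ xs ⟩⇓ 0 → μ f ⟨ xs ⟩⇓ y

triangle : ℕ → ℕ
triangle zero    = 0
triangle (suc i) = suc i + triangle i

-- Cantor's pairing function
pair : ℕ → ℕ → ℕ
pair i j = triangle (i + j) + j

pairᵛ : Var n → ℕ
pairᵛ (σ , i) = pair (toℕ σ) i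

gödel : Formula n → ℕ
gödel (i ≈[ σ ] j) = pair 0 (pair (toℕ σ) (pair i j))
gödel (~ φ)        = pair 1 (gödel φ)
gödel (φ ∧ ψ)      = pair 2 (pair (gödel φ) (gödel ψ))
gödel (φ ∨ ψ)      = pair 3 (pair (gödel φ) (gödel ψ))
gödel (φ ⇒ ψ)      = pair 4 (pair (gödel φ) (gödel ψ))
gödel (all x φ)    = pair 5 (pair (pairᵛ x) (gödel φ))
gödel (ex x φ)     = pair 6 (pair (pairᵛ x) (gödel φ))

Computable : (QFFormula n → QFFormula n) → Set
Computable f =
  ∃[ r ] ∀ φ → r ⟨ gödel (proj₁ φ) ∷ [] ⟩⇓ gödel (proj₁ (f φ))

------------------------------------------------------------------------
-- The three properties, with respect to a set S of sorts.

Finite : Set → Set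
Finite X = ∃[ k ] (X ↔ Fin k)

FiniteModelProperty : Theory n → Subset n → Set₁
FiniteModelProperty T S =
  ∀ φ → QuantifierFree φ → Satisfiable T φ →
  ∃[ A ] A isModelOf T × (A ⊨ φ) × (∀ σ → σ ∈ S → Finite (Dom A σ))

-- A cardinal is given by a set of that cardinality; κ is only constrained
-- on S, so it amounts to a function from S to cardinals.
Smooth : Theory n → Subset n → Set₁
Smooth {n} T S =
  ∀ φ → QuantifierFree φ → ∀ A → A isModelOf T → A ⊨ φ →
  (κ : Fin n → Set) → (∀ σ → σ ∈ S → Dom A σ ↣ κ σ) →
  ∃[ B ] B isModelOf T × (B ⊨ φ) × (∀ σ → σ ∈ S → Dom B σ ↔ κ σ)

-- σ^A = vars_σ(φ)^A; only the inclusion from left to right has content.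
CoveredBy : Interpretation n → Formula n → Fin n → Set
CoveredBy A φ σ = ∀ a → ∃[ i ] (σ , i) ∈ᵛ vars φ × val A (σ , i) ≡ a
  where open DecMembership _≟ᵛ_ renaming (_∈_ to _∈ᵛ_)

IsWitness : Theory n → Subset n → (QFFormula n → QFFormula n) → Set₁
IsWitness T S wit = ∀ φq →
  let φ = proj₁ φq
      ψ = proj₁ (wit φq)
  in Equivalent T φ (ex* (vars ψ ∖ vars φ) ψ)
   × (Satisfiable T ψ →
      ∃[ A ] A isModelOf T × (A ⊨ ψ) × (∀ σ → σ ∈ S → CoveredBy A ψ σ))

FinitelyWitnessable : Theory n → Subset n → Set₁
FinitelyWitnessable T S = ∃[ wit ] Computable wit × IsWitness T S wit

{-# OPTIONS --safe #-}
module Submission where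

-- Over the empty signature the truth of a closed formula depends only on the
-- cardinalities of the domains. By Dickson's lemma, finitely many of the size
-- vectors of finite models of T lie below all the others; let Γ hold one
-- variable per element of each of the corresponding models. The witness of φ
-- conjoins to it trivial equations w ≈ w for a fresh copy of Γ.
--
-- A satisfiable φ has a finite model A, which contains a copy of one of the
-- minimal models B. Let the fresh variables name the elements of that copy,
-- and restrict A to the elements named in the witness. The restriction is an
-- extension of the copy of B, hence by smoothness a model of T, and as a
-- substructure of A it still satisfies the quantifier-free φ.
--
-- Fresh indices start above gödel φ, which bounds the indices in φ, so that
-- the code of the witness is a fixed arithmetic expression in the code of φ.

open import Defs
open import Axiom.ExcludedMiddle using (ExcludedMiddle)
open import Data.Bool.Properties using (T-irrelevant)
open import Data.Fin.Base using (Fin; toℕ; zero; suc; fromℕ<)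
open import Data.Fin.Properties using (toℕ<n; fromℕ<-toℕ; inject≤-injective)
open import Data.Fin.Subset using (⊤)
open import Data.Fin.Subset.Properties using (∈⊤)
open import Data.List.Base
  using (List; []; _∷_; _++_; map; foldr; concatMap; allFin; upTo)
open import Data.List.Extrema.Nat using (max; v≤max⁺)
import Data.List.Membership.DecPropositional as DecMembership
open import Data.List.Membership.Propositional using (_∈_; _∉_; lose; find)
open import Data.List.Membership.Propositional.Properties
  using ( ∈-++⁺ˡ; ∈-++⁺ʳ; ∈-++⁻; ∈-filter⁺; ∈-filter⁻; ∈-map⁺; ∈-concatMap⁺
        ; ∈-upTo⁺; ∈-allFin)
open import Data.List.Relation.Unary.All as All using (All; []; _∷_)
open import Data.List.Relation.Unary.Any as Any using (Any; here; there)
import Data.List.Relation.Unary.Any.Properties as Any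
open import Data.Nat.Base
  using (ℕ; zero; suc; _+_; _∸_; _≤_; _<_; s≤s)
open import Data.Nat.Properties
  using ( _<?_; ≮⇒≥; ≤-trans; ≤-refl; m≤m+n; m≤n+m; m+n∸m≡n
        ; m+n≮m)
open import Data.Product.Base using (Σ; ∃; ∃-syntax; _×_; _,_; proj₁; proj₂)
open import Data.Product.Function.NonDependent.Propositional using (_×-⇔_)
open import Data.Sum.Function.Propositional using (_⊎-⇔_)
open import Data.Sum.Base using (inj₂; [_,_]′)
open import Data.Vec.Base using (Vec; []; _∷_; head; lookup; tabulate)
open import Data.Vec.Properties using (lookup∘tabulate)
open import Data.Vec.Relation.Binary.Pointwise.Inductive as Pointwise
  using (Pointwise; []; _∷_)
open import Function.Base using (id; _∘_; const)
open import Function.Bundles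
  using (_⇔_; _↔_; _↣_; mk⇔; mk↣; module Equivalence; module Inverse; module Injection)
open import Function.Construct.Composition using (_↣-∘_)
open import Function.Construct.Identity using (↔-id)
open import Function.Construct.Symmetry using (↔-sym)
open import Function.Definitions using (Injective)
open import Function.Properties.Inverse using (↔⇒↣)
open import Function.Related.TypeIsomorphisms using (→-cong-⇔; ¬-cong-⇔)
open import Level using (0ℓ; lift; lower)
import Level
open import Relation.Binary.PropositionalEquality
  using (_≡_; refl; sym; trans; cong; subst)
open import Relation.Nullary using (¬_; Dec; ¬?; yes; no; contradiction)
open import Relation.Nullary.Decidable
  using (True; toWitness; fromWitness; map′)

open Equivalence using (to; from)

private
  variable
    n k : ℕ
    σ : Fin n
    A B : Interpretation n
    φ ψ : Formula n

-- Transport of truth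

update-agree : (x : Var n) (f : ∀ {σ} → Dom A σ → Dom B σ)
  {a : Dom A (proj₁ x)} {b : Dom B (proj₁ x)} → f a ≡ b →
  (∀ {y} → y ∈ vars φ without x → f (val A y) ≡ val B y) →
  ∀ {y} → y ∈ vars φ → f (val (A [ x ↦ a ]) y) ≡ val (B [ x ↦ b ]) y
update-agree x f fa≡b agree {y} y∈φ with x ≟ᵛ y
... | yes refl = fa≡b
... | no  x≢y  = agree (∈-filter⁺ _ y∈φ (x≢y ∘ sym))

-- Injectivity settles the equality atoms in both directions, and surjectivity supplies preimages
-- under quantifiers. Guarding surjectivity by `¬ QuantifierFree φ` lets one induction serve both
-- isomorphisms and inclusions of substructures.
⊨-transport : (f : ∀ {σ} → Dom A σ → Dom B σ) →
  (∀ {σ} → Injective _≡_ _≡_ (f {σ})) →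
  ∀ φ → (¬ QuantifierFree φ → ∀ {σ} b → ∃[ a ] f {σ} a ≡ b) →
  (∀ {x} → x ∈ vars φ → f (val A x) ≡ val B x) →
  (A ⊨ φ) ⇔ (B ⊨ φ)
⊨-transport {A = A} {B = B} f inj (i ≈[ σ ] j) surj agree =
  mk⇔ (λ eq → trans (sym fi) (trans (cong f eq) fj))
      (λ eq → inj (trans fi (trans eq (sym fj))))
  where
  fi : f (val A (σ , i)) ≡ val B (σ , i)
  fi = agree (here refl)
  fj : f (val A (σ , j)) ≡ val B (σ , j)
  fj = agree (there (here refl))
⊨-transport f inj (~ φ) surj agree =
  ¬-cong-⇔ (⊨-transport f inj φ (λ ¬q → surj λ { (qf-~ q) → ¬q q }) agree)
⊨-transport f inj (φ ∧ ψ) surj agree =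
  ⊨-transport f inj φ (λ ¬q → surj λ { (qf-∧ q _) → ¬q q }) (agree ∘ ∈-++⁺ˡ) ×-⇔
  ⊨-transport f inj ψ (λ ¬q → surj λ { (qf-∧ _ q) → ¬q q }) (agree ∘ ∈-++⁺ʳ (vars φ))
⊨-transport f inj (φ ∨ ψ) surj agree =
  ⊨-transport f inj φ (λ ¬q → surj λ { (qf-∨ q _) → ¬q q }) (agree ∘ ∈-++⁺ˡ) ⊎-⇔
  ⊨-transport f inj ψ (λ ¬q → surj λ { (qf-∨ _ q) → ¬q q }) (agree ∘ ∈-++⁺ʳ (vars φ))
⊨-transport f inj (φ ⇒ ψ) surj agree = →-cong-⇔
  (⊨-transport f inj φ (λ ¬q → surj λ { (qf-⇒ q _) → ¬q q }) (agree ∘ ∈-++⁺ˡ))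
  (⊨-transport f inj ψ (λ ¬q → surj λ { (qf-⇒ _ q) → ¬q q }) (agree ∘ ∈-++⁺ʳ (vars φ)))
⊨-transport {A = A} {B = B} f inj (all x φ) surj agree =
  -- No constructor makes a quantified formula quantifier-free, so `λ ()` opens the guard and every
  -- `b` has a preimage.
  mk⇔ (λ p b → let a , fa≡b = surj (λ ()) b in to (body fa≡b) (p a))
      (λ p a → from (body refl) (p (f a)))
  where
  body : ∀ {a b} → f a ≡ b → (A [ x ↦ a ] ⊨ φ) ⇔ (B [ x ↦ b ] ⊨ φ)
  body fa≡b = ⊨-transport f inj φ (λ _ → surj (λ ())) (update-agree {A = A} {B} {φ} x f fa≡b agree)
⊨-transport {A = A} {B = B} f inj (ex x φ) surj agree =
  mk⇔ (λ (a , p) → f a , to (body refl) p)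
      (λ (b , p) → let a , fa≡b = surj (λ ()) b in a , from (body fa≡b) p)
  where
  body : ∀ {a b} → f a ≡ b → (A [ x ↦ a ] ⊨ φ) ⇔ (B [ x ↦ b ] ⊨ φ)
  body fa≡b = ⊨-transport f inj φ (λ _ → surj (λ ())) (update-agree {A = A} {B} {φ} x f fa≡b agree)

revalue : (A : Interpretation n) → ((x : Var n) → Dom A (proj₁ x)) → Interpretation n
revalue A v = record { Dom = Dom A ; val = v }

coincidence : ∀ {v} φ → (∀ {x} → x ∈ vars φ → val A x ≡ v x) → (A ⊨ φ) ⇔ (revalue A v ⊨ φ)
coincidence φ = ⊨-transport id id φ (λ _ b → b , refl)

-- There are no symbols to preserve, so sortwise bijections form an isomorphism; axioms are closed,
-- so agreement on their free variables is vacuous.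
isModelOf-resp-↔ : (T : Theory n) → (∀ σ → Dom A σ ↔ Dom B σ) → A isModelOf T → B isModelOf T
isModelOf-resp-↔ {A = A} {B = B} T f A⊨T {φ} ax =
  to (⊨-transport (λ {σ} → Inverse.to (f σ)) (λ {σ} → Injection.injective (↔⇒↣ (f σ))) φ
       (λ _ {σ} b → Inverse.from (f σ) b , Inverse.strictlyInverseˡ (f σ) b) agree)
     (A⊨T ax)
  where
  agree : ∀ {x} → x ∈ vars φ → Inverse.to (f (proj₁ x)) (val A x) ≡ val B x
  agree x∈φ with () ← subst (_ ∈_) (closed T ax) x∈φ

revalue-isModelOf : (T : Theory n) (A : Interpretation n) → ∀ {v} →
  A isModelOf T → revalue A v isModelOf T
revalue-isModelOf T A = isModelOf-resp-↔ T (λ σ → ↔-id (Dom A σ))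

update-fresh : ∀ {x : Var n} {a} φ → x ∉ vars φ → (A ⊨ φ) ⇔ (A [ x ↦ a ] ⊨ φ)
update-fresh {A = A} {x = x} {a} φ x∉φ = coincidence φ agree
  where
  agree : ∀ {y} → y ∈ vars φ → val A y ≡ val (A [ x ↦ a ]) y
  agree {y} y∈φ with x ≟ᵛ y
  ... | yes refl = contradiction y∈φ x∉φ
  ... | no  _    = refl

-- Each quantifier changes the valuation, hence the equivalence is assumed in all interpretations.
-- Since `x` is not free in `φ`, any value would do as a witness; the current one is taken.
ex*-vacuous : ∀ xs → All (_∉ vars φ) xs → (∀ A → (A ⊨ φ) ⇔ (A ⊨ ψ)) →
  ∀ A → (A ⊨ φ) ⇔ (A ⊨ ex* xs ψ)
ex*-vacuous []       []           φ⇔ψ A = φ⇔ψ A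
ex*-vacuous {φ = φ} (x ∷ xs) (x∉φ ∷ xs∉φ) φ⇔ψ A =
  mk⇔ (λ p → val A x , to (ih (A [ x ↦ val A x ])) (to (update-fresh φ x∉φ) p))
      (λ (a , p) → from (update-fresh φ x∉φ) (from (ih (A [ x ↦ a ])) p))
  where ih = ex*-vacuous xs xs∉φ φ⇔ψ

-- Padding

pad : ℕ → List (Var n) → Formula n → Formula n
pad N Γ φ = foldr (λ (σ , i) χ → (N + i) ≈[ σ ] (N + i) ∧ χ) φ Γ

pad-quantifierFree : ∀ N Γ → QuantifierFree φ → QuantifierFree (pad N Γ φ)
pad-quantifierFree N []      q = q
pad-quantifierFree N (_ ∷ Γ) q = qf-∧ qf-≈ (pad-quantifierFree N Γ q)

⊨-pad : ∀ N Γ (A : Interpretation n) → (A ⊨ φ) ⇔ (A ⊨ pad N Γ φ)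
⊨-pad N []      A = mk⇔ id id
⊨-pad N (_ ∷ Γ) A = mk⇔ (λ p → refl , to (⊨-pad N Γ A) p) (λ (_ , p) → from (⊨-pad N Γ A) p)

∈-vars-pad : ∀ N {Γ i} → (σ , i) ∈ Γ → (σ , N + i) ∈ vars (pad N Γ φ)
∈-vars-pad N (here refl) = here refl
∈-vars-pad N (there x∈Γ) = there (there (∈-vars-pad N x∈Γ))

m≤pair : ∀ i j → i ≤ pair i j
m≤pair i j = ≤-trans (m≤m+n i j) (≤-trans (n≤triangle (i + j)) (m≤m+n _ j))
  where
  n≤triangle : ∀ n → n ≤ triangle n
  n≤triangle zero    = ≤-refl
  n≤triangle (suc n) = m≤m+n (suc n) _

n≤pair : ∀ i j → j ≤ pair i j
n≤pair i j = m≤n+m j _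

∈-++-pair : ∀ c {a b i} {x : Var n} xs {ys} → (x ∈ xs → i ≤ a) → (x ∈ ys → i ≤ b) →
  x ∈ xs ++ ys → i ≤ pair c (pair a b)
∈-++-pair c {a} {b} xs i≤a i≤b x∈ = ≤-trans
  ([ (λ x∈xs → ≤-trans (i≤a x∈xs) (m≤pair a b)) , (λ x∈ys → ≤-trans (i≤b x∈ys) (n≤pair a b)) ]′
    (∈-++⁻ xs x∈))
  (n≤pair c _)

-- Pairing dominates both of its arguments, so a code bounds every index that went into it.
var≤gödel : ∀ {i} → QuantifierFree φ → (σ , i) ∈ vars φ → i ≤ gödel φ
var≤gödel (qf-≈ {i} {σ} {j}) (here refl) =
  ≤-trans (m≤pair i j) (≤-trans (n≤pair (toℕ σ) _) (n≤pair 0 _))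
var≤gödel (qf-≈ {i} {σ} {j}) (there (here refl)) =
  ≤-trans (n≤pair i j) (≤-trans (n≤pair (toℕ σ) _) (n≤pair 0 _))
var≤gödel (qf-~ q) = λ x∈φ → ≤-trans (var≤gödel q x∈φ) (n≤pair 1 _)
var≤gödel {φ = φ ∧ _} (qf-∧ p q) = ∈-++-pair 2 (vars φ) (var≤gödel p) (var≤gödel q)
var≤gödel {φ = φ ∨ _} (qf-∨ p q) = ∈-++-pair 3 (vars φ) (var≤gödel p) (var≤gödel q)
var≤gödel {φ = φ ⇒ _} (qf-⇒ p q) = ∈-++-pair 4 (vars φ) (var≤gödel p) (var≤gödel q)

-- Recursive functions

Recursive : (Vec ℕ k → ℕ) → Set
Recursive {k} f = ∃[ r ] ∀ (xs : Vec ℕ k) → r ⟨ xs ⟩⇓ f xs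

projection : (i : Fin k) → Recursive (λ xs → lookup xs i)
projection i = proj i , λ xs → ⇓proj

constant : ∀ c → Recursive {k} (const c)
constant zero    = comp zeroᵣ [] , λ xs → ⇓comp [] ⇓zero
constant (suc c) = comp sucᵣ (r ∷ []) , λ xs → ⇓comp (⇓r xs ∷ []) ⇓suc
  where
  r  = proj₁ (constant c)
  ⇓r = proj₂ (constant c)

private
  variable
    F G H : Vec ℕ k → ℕ

compose₁ : Recursive H → Recursive {k} F → Recursive (λ xs → H (F xs ∷ []))
compose₁ (r , ⇓r) (s , ⇓s) =
  comp r (s ∷ []) , λ xs → ⇓comp (⇓s xs ∷ []) (⇓r _)

compose₂ : Recursive H → Recursive {k} F → Recursive {k} G →
  Recursive (λ xs → H (F xs ∷ G xs ∷ []))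
compose₂ (r , ⇓r) (s , ⇓s) (t , ⇓t) =
  comp r (s ∷ t ∷ []) , λ xs → ⇓comp (⇓s xs ∷ ⇓t xs ∷ []) (⇓r _)

suc-recursive : Recursive {1} (λ { (i ∷ []) → suc i })
suc-recursive = sucᵣ , λ { (i ∷ []) → ⇓suc }

+-recursive : Recursive {2} (λ { (i ∷ j ∷ []) → i + j })
+-recursive = prec (proj zero) step , λ { (i ∷ j ∷ []) → ⇓+ i j }
  where
  -- `prec` passes its step the counter first and the previous value second.
  step = comp sucᵣ (proj (suc zero) ∷ [])
  ⇓+ : ∀ i j → prec (proj zero) step ⟨ i ∷ j ∷ [] ⟩⇓ i + j
  ⇓+ zero    j = ⇓prec-zero ⇓proj
  ⇓+ (suc i) j = ⇓prec-suc (⇓+ i j) (⇓comp (⇓proj ∷ []) ⇓suc)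

triangle-recursive : Recursive {1} (λ { (i ∷ []) → triangle i })
triangle-recursive = prec zeroᵣ (proj₁ step) , λ { (i ∷ []) → ⇓triangle i }
  where
  step = compose₂ +-recursive (compose₁ suc-recursive (projection zero)) (projection (suc zero))
  ⇓triangle : ∀ i → prec zeroᵣ (proj₁ step) ⟨ i ∷ [] ⟩⇓ triangle i
  ⇓triangle zero    = ⇓prec-zero ⇓zero
  ⇓triangle (suc i) = ⇓prec-suc (⇓triangle i) (proj₂ step _)

pair-recursive : Recursive {k} F → Recursive {k} G → Recursive (λ xs → pair (F xs) (G xs))
pair-recursive r s = compose₂ +-recursive (compose₁ triangle-recursive (compose₂ +-recursive r s)) s

padCode : ℕ → List (Var n) → ℕ → ℕ
padCode N Γ c =
  foldr (λ (σ , i) d → pair 2 (pair (pair 0 (pair (toℕ σ) (pair (N + i) (N + i)))) d)) c Γ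

gödel-pad : ∀ N Γ (φ : Formula n) → gödel (pad N Γ φ) ≡ padCode N Γ (gödel φ)
gödel-pad N []            φ = refl
gödel-pad N ((σ , i) ∷ Γ) φ =
  cong (λ d → pair 2 (pair (gödel ((N + i) ≈[ σ ] (N + i))) d)) (gödel-pad N Γ φ)

-- As `Γ` is fixed, the recursion over it is unfolded while the program is assembled. The program
-- never decodes the formula: it uses the code as the innermost entry and, incremented, as the index
-- offset.
padCode-recursive : (Γ : List (Var n)) → Recursive {1} (λ xs → padCode (suc (head xs)) Γ (head xs))
padCode-recursive []            = proj zero , λ { (_ ∷ []) → ⇓proj }
padCode-recursive ((σ , i) ∷ Γ) = pair-recursive (constant 2) (pair-recursive
  (pair-recursive (constant 0) (pair-recursive (constant (toℕ σ)) (pair-recursive index index)))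
  (padCode-recursive Γ))
  where
  index : Recursive {1} (λ xs → suc (head xs) + i)
  index = compose₂ +-recursive (compose₁ suc-recursive (proj zero , λ { (_ ∷ []) → ⇓proj })) (constant i)

-- Finitely many models

-- Induction on the length, with excluded middle deciding `P []` in the base case. Basis vectors
-- keep their proofs of `P`, so that for `P = Sizes T` each of them comes with a model.
dickson : ExcludedMiddle (Level.suc 0ℓ) → ∀ {n} (P : Vec ℕ n → Set₁) →
  ∃[ L ] ∀ {v} → P v → Any {A = ∃ P} (λ m → Pointwise _≤_ (proj₁ m) v) L
dickson em {zero} P with em {P []}
... | yes p = ([] , p) ∷ [] , λ { {[]} _ → here [] }
... | no ¬p = [] , λ { {[]} p → contradiction p ¬p }
dickson em {suc n} P = L ++ concatMap slice (upTo M) , cover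
  where
  -- Above every head occurring in a basis of the projection of P, that basis
  -- covers P; each of the finitely many smaller heads x gets its own slice.
  tail-basis = dickson em (λ v → ∃[ x ] P (x ∷ v))
  slice-basis = λ x → dickson em (λ v → P (x ∷ v))
  L = map (λ (v , x , p) → (x ∷ v) , p) (proj₁ tail-basis)
  slice = λ x → map (λ (v , p) → (x ∷ v) , p) (proj₁ (slice-basis x))
  M = max 0 (map (λ (v , x , p) → x) (proj₁ tail-basis))

  cover : ∀ {v} → P v → Any (λ m → Pointwise _≤_ (proj₁ m) v) (L ++ concatMap slice (upTo M))
  cover {x ∷ v} p with x <? M
  ... | yes x<M = Any.++⁺ʳ L (Any.concatMap⁺ slice (lose (∈-upTo⁺ x<M)
          (Any.map⁺ (Any.map (≤-refl ∷_) (proj₂ (slice-basis x) p)))))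
  ... | no  x≮M = Any.++⁺ˡ (Any.map⁺ (lose m∈ (≤-trans ≤M (≮⇒≥ x≮M) ∷ m≤v)))
    where
    found = find (proj₂ tail-basis (x , p))
    m∈  = proj₁ (proj₂ found)
    m≤v = proj₂ (proj₂ found)
    ≤M = v≤max⁺ 0 _ (inj₂ (Any.map⁺ (lose m∈ ≤-refl)))

Sizes : Theory n → Vec ℕ n → Set₁
Sizes T c = ∃[ A ] A isModelOf T × (∀ σ → Dom A σ ↔ Fin (lookup c σ))

module _ (A : Interpretation n) (c : Vec ℕ n) (size : ∀ σ → Dom A σ ↔ Fin (lookup c σ)) where

  -- Junk value: indices beyond the size of the domain repeat val A (σ , 0).
  enumerate : (x : Var n) → Dom A (proj₁ x)
  enumerate (σ , j) with j <? lookup c σ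
  ... | yes j<c = Inverse.from (size σ) (fromℕ< j<c)
  ... | no  _   = val A (σ , 0)

  enumerate-surjective : ∀ {σ} a → enumerate (σ , toℕ (Inverse.to (size σ) a)) ≡ a
  enumerate-surjective {σ} a with toℕ (Inverse.to (size σ) a) <? lookup c σ
  ... | yes j<c = trans (cong (Inverse.from (size σ)) (fromℕ<-toℕ _ j<c)) (Inverse.strictlyInverseʳ (size σ) a)
  ... | no  j≮c = contradiction (toℕ<n _) j≮c

indices : Vec ℕ n → List (Var n)
indices c = concatMap (λ σ → map (σ ,_) (upTo (lookup c σ))) (allFin _)

∈-indices : ∀ {c : Vec ℕ n} {j} → j < lookup c σ → (σ , j) ∈ indices c
∈-indices {σ = σ} {c = c} j<c =
  ∈-concatMap⁺ (λ σ → map (σ ,_) (upTo (lookup c σ))) (lose (∈-allFin σ) (∈-map⁺ (σ ,_) (∈-upTo⁺ j<c)))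

Named : (A : Interpretation n) → List (Var n) → (σ : Fin n) → Dom A σ → Set
Named A Γ σ a = ∃[ i ] (σ , i) ∈ Γ × val A (σ , i) ≡ a

-- A basis model stays a model when revalued by `enumerate`, and then all its elements are named.
-- `Γ` is shared by all basis models, so variables listed for a larger one may take junk values in a
-- smaller one. Componentwise comparison of sizes gives the embeddings.
small-models : ExcludedMiddle (Level.suc 0ℓ) → (T : Theory n) →
  ∃[ Γ ] ∀ A → A isModelOf T → (∀ σ → Finite (Dom A σ)) →
    ∃[ B ] B isModelOf T × (∀ σ → Dom B σ ↣ Dom A σ) × (∀ σ b → Named B Γ σ b)
small-models {n} em T = concatMap (indices ∘ proj₁) L , minorant
  where
  L = proj₁ (dickson em (Sizes T))

  minorant : ∀ A → A isModelOf T → (∀ σ → Finite (Dom A σ)) →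
    ∃[ B ] B isModelOf T × (∀ σ → Dom B σ ↣ Dom A σ) ×
      (∀ σ b → Named B (concatMap (indices ∘ proj₁) L) σ b)
  minorant A A⊨T fin with find (proj₂ (dickson em (Sizes T)) {tabulate (proj₁ ∘ fin)} (A , A⊨T , A-size))
    where
    A-size : ∀ σ → Dom A σ ↔ Fin (lookup (tabulate (proj₁ ∘ fin)) σ)
    A-size σ = subst (λ k → Dom A σ ↔ Fin k) (sym (lookup∘tabulate (proj₁ ∘ fin) σ)) (proj₂ (fin σ))
  ... | (c , B , B⊨T , size) , m∈L , c≤ =
    revalue B (enumerate B c size) , revalue-isModelOf T B B⊨T , embed ,
    λ σ b → _ , ∈-concatMap⁺ (indices ∘ proj₁) (lose m∈L (∈-indices {c = c} (toℕ<n (Inverse.to (size σ) b)))) ,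
      enumerate-surjective B c size b
    where
    embed : ∀ σ → Dom B σ ↣ Dom A σ
    embed σ = ↔⇒↣ (↔-sym (proj₂ (fin σ))) ↣-∘ (mk↣ (inject≤-injective c≤fin c≤fin _ _) ↣-∘ ↔⇒↣ (size σ))
      where
      c≤fin : lookup c σ ≤ proj₁ (fin σ)
      c≤fin = subst (lookup c σ ≤_) (lookup∘tabulate (proj₁ ∘ fin) σ) (Pointwise.lookup c≤ σ)

-- Restriction

module Restriction (em : ExcludedMiddle 0ℓ) (A : Interpretation n) (Γ : List (Var n))
  (inhabited : ∀ σ → ∃[ i ] (σ , i) ∈ Γ) where

  open DecMembership (_≟ᵛ_ {n}) using (_∈?_)

  -- An arbitrary domain carries no decision procedure for equality, so the decision is classical.
  named? : ∀ σ a → Dec (Named A Γ σ a)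
  named? σ a = em

  -- True makes the membership proof irrelevant, so that inclusion is injective.
  Part : Fin n → Set
  Part σ = Σ (Dom A σ) λ a → True (named? σ a)

  inclusion-injective : ∀ {σ} → Injective _≡_ _≡_ (proj₁ {A = Dom A σ} {B = λ a → True (named? σ a)})
  inclusion-injective {x = a , s} {y = .a , t} refl = cong (a ,_) (T-irrelevant s t)

  point : ∀ {σ i} → (σ , i) ∈ Γ → Part σ
  point x∈Γ = _ , fromWitness (_ , x∈Γ , refl)

  restriction : Interpretation n
  Dom restriction σ = Part σ
  val restriction x with x ∈? Γ
  ... | yes x∈Γ = point x∈Γ
  -- Default value: some named element of the same sort.
  ... | no  _   = point (proj₂ (inhabited (proj₁ x)))

  val-restriction : ∀ {x} → x ∈ Γ → proj₁ (val restriction x) ≡ val A x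
  val-restriction {x} x∈Γ with x ∈? Γ
  ... | yes _   = refl
  ... | no  x∉Γ = contradiction x∈Γ x∉Γ

  restriction-named : ∀ σ a → Named restriction Γ σ a
  restriction-named σ (a , t) with toWitness t
  ... | i , x∈Γ , eq = i , x∈Γ , inclusion-injective (trans (val-restriction x∈Γ) eq)

module _ (N : ℕ) (A B : Interpretation n) (f : ∀ σ → Dom B σ → Dom A σ) where

  -- With `N` above all indices in `φ`, the truth of `φ` is kept from `A`, while the padding
  -- variables name the image of `B`.
  splice : Interpretation n
  Dom splice = Dom A
  val splice (σ , i) with i <? N
  ... | yes _ = val A (σ , i)
  ... | no  _ = f σ (val B (σ , i ∸ N))

  val-splice-< : ∀ {i} → i < N → val A (σ , i) ≡ val splice (σ , i)
  val-splice-< {i = i} i<N with i <? N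
  ... | yes _   = refl
  ... | no  i≮N = contradiction i<N i≮N

  val-splice-+ : ∀ i → val splice (σ , N + i) ≡ f σ (val B (σ , i))
  val-splice-+ {σ = σ} i with N + i <? N
  ... | yes N+i<N = contradiction N+i<N (m+n≮m N i)
  ... | no  _     = cong (λ j → f σ (val B (σ , j))) (m+n∸m≡n N i)

-- The witness function

module _ (em : ExcludedMiddle (Level.suc 0ℓ)) (T : Theory n)
  (fmp : FiniteModelProperty T ⊤) (smooth : Smooth T ⊤) where

  private
    em₀ : ExcludedMiddle 0ℓ
    em₀ = map′ lower lift em

    Γ : List (Var n)
    Γ = proj₁ (small-models em T)

  wit : QFFormula n → QFFormula n
  wit (φ , q) = pad (suc (gödel φ)) Γ φ , pad-quantifierFree (suc (gödel φ)) Γ q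

  wit-computable : Computable wit
  wit-computable = proj₁ (padCode-recursive Γ) , λ (φ , _) →
    subst (proj₁ (padCode-recursive Γ) ⟨ gödel φ ∷ [] ⟩⇓_) (sym (gödel-pad (suc (gödel φ)) Γ φ))
      (proj₂ (padCode-recursive Γ) (gödel φ ∷ []))

  module _ {φ : Formula n} (q : QuantifierFree φ) where

    private
      N : ℕ
      N = suc (gödel φ)

      φ⁺ : Formula n
      φ⁺ = pad N Γ φ

    wit-covered : Satisfiable T φ⁺ → ∃[ C ] C isModelOf T × (C ⊨ φ⁺) × (∀ σ → CoveredBy C φ⁺ σ)
    wit-covered (A₀ , A₀⊨T , A₀⊨φ⁺)
      -- The finite model is sought for `φ` alone, because the padding variables are revalued
      -- afterwards.
      with A , A⊨T , A⊨φ , fin ← fmp φ q (A₀ , A₀⊨T , from (⊨-pad N Γ A₀) A₀⊨φ⁺)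
      with B , B⊨T , embed , B-named ← proj₂ (small-models em T) A A⊨T (λ σ → fin σ ∈⊤)
      = restriction , restriction⊨T , restriction⊨φ⁺ , restriction-named
      where
      f : ∀ σ → Dom B σ → Dom A σ
      f σ = Injection.to (embed σ)

      A′ : Interpretation n
      A′ = splice N A B f

      A′⊨φ⁺ : A′ ⊨ φ⁺
      A′⊨φ⁺ = to (⊨-pad N Γ A′)
        (to (coincidence φ (λ x∈φ → val-splice-< N A B f (s≤s (var≤gödel q x∈φ)))) A⊨φ)

      A′-named : ∀ {σ} b → Named A′ (vars φ⁺) σ (f σ b)
      A′-named {σ} b with i , x∈Γ , eq ← B-named σ b =
        N + i , ∈-vars-pad N x∈Γ , trans (val-splice-+ N A B f i) (cong (f σ) eq)

      inhabited : ∀ σ → ∃[ i ] (σ , i) ∈ vars φ⁺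
      -- `val B (σ , 0)` serves as an arbitrary element of the nonempty domain; its image has a
      -- name.
      inhabited σ with i , x∈φ⁺ , _ ← A′-named (val B (σ , 0)) = i , x∈φ⁺

      open Restriction em₀ A′ (vars φ⁺) inhabited

      -- The cardinality bound demanded by smoothness: the restriction contains the whole image of
      -- `B`.
      embed-part : ∀ σ → Dom B σ ↣ Part σ
      embed-part σ = mk↣ {to = λ b → f σ b , fromWitness (A′-named b)}
        (Injection.injective (embed σ) ∘ cong proj₁)

      -- Smoothness is applied to a tautology: only cardinalities matter for a
      -- model of closed axioms, while φ is secured by restriction⊨φ⁺.
      restriction⊨T : restriction isModelOf T
      restriction⊨T
        with C , C⊨T , _ , size ← smooth (φ ⇒ φ) (qf-⇒ q q) B B⊨T id Part (λ σ _ → embed-part σ)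
        = isModelOf-resp-↔ T (λ σ → size σ ∈⊤) C⊨T

      restriction⊨φ⁺ : restriction ⊨ φ⁺
      restriction⊨φ⁺ = from
        -- The inclusion may fail to be onto; quantifier-freeness of `φ⁺` refutes the guard on
        -- surjectivity.
        (⊨-transport proj₁ inclusion-injective φ⁺ (contradiction (pad-quantifierFree N Γ q)) val-restriction)
        A′⊨φ⁺

    -- Pure logic: the padding is valid and the quantified variables do not occur in `φ`.
    wit-equivalent : Equivalent T φ (ex* (vars φ⁺ ∖ vars φ) φ⁺)
    wit-equivalent A _ =
      ex*-vacuous (vars φ⁺ ∖ vars φ)
        (All.tabulate (proj₂ ∘ ∈-filter⁻ (λ x → ¬? (x ∈? vars φ)) {xs = vars φ⁺})) (⊨-pad N Γ) A
      where open DecMembership (_≟ᵛ_ {n}) using (_∈?_)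

theorem5 : ExcludedMiddle (Level.suc 0ℓ) → (n : ℕ) (T : Theory n) → FiniteModelProperty T ⊤ → Smooth T ⊤ → FinitelyWitnessable T ⊤
theorem5 em n T fmp smooth = wit em T fmp smooth , wit-computable em T fmp smooth , λ (φ , q) →
  wit-equivalent em T fmp smooth q ,
  λ sat → let A , A⊨T , A⊨ψ , covered = wit-covered em T fmp smooth q sat in
    A , A⊨T , A⊨ψ , λ σ _ → covered σ
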